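{- Let $R$ be a commutative associative ring with $1$, let $a,b\in R$, and let $m$ be a positive integer. Let $C_{2m}(a,b)$ be the symmetric Toeplitz matrix of order $2m$ over $R$ with first row $(0,b,a,b,\dots,b)$; that is, the $(i,j)$ entry is $0$ if $i=j$, is $a$ if $|i-j|=2$, and is $b$ otherwise. With the convention $0^0=1$, $$ \mathrm{Hf}(C_{2m}(a,b))=\sum_{k=p}^m (a-b)^{m-k}\,b^k\,\frac{(2k)!}{k!\,2^k}\sum_{i=\max\left(0,\left\lceil \frac{m-3k}{2}\right\rceil\right)}^{\left\lfloor \frac{m-k}{2}\right\rfloor}\binom{2k+i}{m-k-i}\binom{m-k-i}{i}, $$ where $p=0$ when $m$ is even and $p=1$ when $m$ is odd.
   Context: For a symmetric matrix $A=(a_{ij})$ of even order $n$ over a commutative associative ring, the hafnian of $A$ is $$\mathrm{Hf}(A)=\sum_{(i_1i_2|\dots|i_{n-1}i_n)} a_{i_1i_2}\cdots a_{i_{n-1}i_n},$$ where the sum ranges over all unordered partitions of the set $\{1,2,\dots,n\}$ into unordered pairs $(i_1i_2),\dots,(i_{n-1}i_n)$. The numbers $\frac{(2k)!}{k!\,2^k}$ are integers; integers act on $R$ in the usual way (as integer multiples). The convention $0^0=1$ means $x^0=1$ for every $x\in R$, including $x=0$. -}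

module Defs where

open import Algebra.Bundles using (CommutativeRing)
open import Data.Fin.Base using (Fin; toℕ)
open import Data.List.Base as List using (List; concatMap; upTo)
open import Data.Nat.Base
  using (ℕ; zero; suc; _+_; _*_; _∸_; _^_; _/_; _!; NonZero; ∣_-_∣)
import Data.Nat.ListAction as ℕ
open import Data.Nat.Properties using (_!≢0; m*n≢0; m^n≢0)
open import Data.Product.Base using (_×_; _,_; uncurry)
open import Data.Vec.Base as Vec using (Vec; []; _∷_; lookup; removeAt; allFin)

-- lo, lo + 1, …, hi; empty when lo > hi.
infix 5 _⋯_
_⋯_ : ℕ → ℕ → List ℕ
lo ⋯ hi = List.map (lo +_) (upTo (suc hi ∸ lo))

∑ℕ : ∀ {a} {A : Set a} → List A → (A → ℕ) → ℕ
∑ℕ xs f = ℕ.sum (List.map f xs)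

infix 4 ∑ℕ
syntax ∑ℕ xs (λ x → e) = ∑ℕ[ x ∈ xs ] e

-- (2k)! / (k! 2ᵏ); the division is exact.
pairingNumber : ℕ → ℕ
pairingNumber k = (2 * k) ! / (k ! * 2 ^ k)
  where instance
    denominator≢0 : NonZero (k ! * 2 ^ k)
    denominator≢0 = m*n≢0 (k !) (2 ^ k) {{k !≢0}} {{m^n≢0 2 k}}

-- All partitions into unordered pairs of the set of entries of a vector
-- (taken to be distinct), each partition once. An unordered pair is listed
-- with its earlier entry first, and the pairs of a partition are listed in
-- the order of their first components: the first entry x is paired with some
-- later entry y, and what remains is partitioned in the same way.
-- The length m * 2 makes suc m * 2 reduce to suc (suc (m * 2)).
pairings : ∀ {a} {A : Set a} (m : ℕ) → Vec A (m * 2) → List (Vec (A × A) m)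
pairings zero    []       = List.[ [] ]
pairings (suc m) (x ∷ xs) = concatMap
  (λ j → List.map ((x , lookup xs j) ∷_) (pairings m (removeAt xs j)))
  (List.allFin (suc (m * 2)))

module HafnianOver {c ℓ} (R : CommutativeRing c ℓ) where

  open CommutativeRing R using (Carrier; 0#; 1#)
    renaming (_+_ to _+ᴿ_; _*_ to _*ᴿ_)

  ∑ : ∀ {a} {A : Set a} → List A → (A → Carrier) → Carrier
  ∑ xs f = List.foldr _+ᴿ_ 0# (List.map f xs)

  infix 4 ∑
  syntax ∑ xs (λ x → e) = ∑[ x ∈ xs ] e

  ∏ : ∀ {n} → Vec Carrier n → Carrier
  ∏ = Vec.foldr′ _*ᴿ_ 1#

  Matrix : ℕ → Set c
  Matrix n = Fin n → Fin n → Carrier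

  -- Only the entries with i < j are used; for a symmetric matrix this is
  -- independent of the order in which an unordered pair is listed.
  Hf : (m : ℕ) → Matrix (m * 2) → Carrier
  Hf m A = ∑[ π ∈ pairings m (allFin (m * 2)) ] ∏ (Vec.map (uncurry A) π)

  -- The first row (0, b, a, b, b, …), indexed from 0.
  firstRow : Carrier → Carrier → ℕ → Carrier
  firstRow a b 0 = 0#
  firstRow a b 2 = a
  firstRow a b _ = b

  C : (n : ℕ) → Carrier → Carrier → Matrix n
  C n a b i j = firstRow a b ∣ toℕ i - toℕ j ∣

{-# OPTIONS --safe #-}

-- Write the entry w of the matrix as b + d. Expanding the product over each pairing of 2m points
-- and collecting the pairs that contribute d gives
--   Hf(w) = Σ_{k+j=m} bᵏ (2k−1)!! μ_j,
-- where μ_j sums the d-weights of all j-edge matchings. For C_{2m}(a,b), d is a − b at distance 2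
-- and 0 at other positive distances, so μ_j is (a − b)ʲ times the number of ways to choose j
-- disjoint pairs {x, x + 2} in an interval of 2m points; scanning the interval from the left,
-- that number is found as a sum of products of binomial coefficients.

module Submission where

open import Algebra.Bundles using (CommutativeMonoid; CommutativeRing)
import Algebra.Properties.CommutativeMonoid.Mult as CommutativeMonoidMult
import Algebra.Properties.CommutativeSemigroup as CommutativeSemigroupProperties
import Algebra.Properties.Group as GroupProperties
import Algebra.Properties.Semiring.Exp as Exp
import Algebra.Properties.Semiring.Mult as Mult
import Algebra.Solver.Ring.NaturalCoefficients.Default as RingSolver
open import Data.Fin.Base using (Fin; zero; suc; toℕ)
open import Data.List.Base as List
  using (List; []; _∷_; _++_; applyUpTo; upTo; length; iterate; concatMap)
import Data.List.Properties as List
open import Data.Nat as ℕ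
  using (ℕ; zero; suc; NonZero; _∸_; _%_; _≤_; _<_; z≤n; s≤s; ⌊_/2⌋; ⌈_/2⌉; _!; ∣_-_∣)
open import Data.Nat.Combinatorics using (nCk+nC[k+1]≡[n+1]C[k+1]; k>n⇒nCk≡0)
  renaming (_C_ to _choose_)
import Data.Nat.DivMod as ℕ
import Data.Nat.ListAction as ℕ
import Data.Nat.Properties as ℕ
import Data.Nat.Solver as ℕ
open import Data.Product.Base using (_,_; uncurry)
open import Data.Vec.Base as Vec using (Vec; []; _∷_; toList; lookup; removeAt)
import Data.Vec.Properties as Vec
open import Function.Base using (_∘_)
open import Relation.Binary.PropositionalEquality as ≡ using (_≡_; cong; cong₂; module ≡-Reasoning)
open import Relation.Nullary using (yes; no)
open import Defs

-- Sums over pairs of indices with a fixed total.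

module Antidiagonal {c ℓ} (M : CommutativeMonoid c ℓ) where
  open CommutativeMonoid M
  open CommutativeSemigroupProperties commutativeSemigroup using (interchange)

  -- Both indices are passed to the summand, so that reindexing involves no truncated subtraction.
  -- The monoid is arbitrary because both natural numbers and ring elements are summed this way.
  antidiagonal : (ℕ → ℕ → Carrier) → ℕ → Carrier
  antidiagonal h zero    = h 0 0
  antidiagonal h (suc n) = h 0 (suc n) ∙ antidiagonal (h ∘ suc) n

  antidiagonal-cong : ∀ {h h′} n → (∀ i j → i ℕ.+ j ≡ n → h i j ≈ h′ i j) →
                      antidiagonal h n ≈ antidiagonal h′ n
  antidiagonal-cong zero    h≈h′ = h≈h′ 0 0 ≡.refl
  antidiagonal-cong (suc n) h≈h′ =
    ∙-cong (h≈h′ 0 (suc n) ≡.refl)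
           (antidiagonal-cong n (λ i j i+j≡n → h≈h′ (suc i) j (cong suc i+j≡n)))

  antidiagonal-∙ : ∀ h h′ n → antidiagonal (λ i j → h i j ∙ h′ i j) n ≈
                   antidiagonal h n ∙ antidiagonal h′ n
  antidiagonal-∙ h h′ zero    = refl
  antidiagonal-∙ h h′ (suc n) =
    trans (∙-congˡ (antidiagonal-∙ (h ∘ suc) (h′ ∘ suc) n)) (interchange _ _ _ _)

  antidiagonal-last : ∀ h n → antidiagonal h (suc n) ≈
                      antidiagonal (λ i j → h i (suc j)) n ∙ h (suc n) 0
  antidiagonal-last h zero    = refl
  antidiagonal-last h (suc n) =
    trans (∙-congˡ (antidiagonal-last (h ∘ suc) n)) (sym (assoc _ _ _))

  antidiagonal-applyUpTo : ∀ h n → antidiagonal h n ≈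
    List.foldr _∙_ ε (applyUpTo (λ i → h i (n ∸ i)) (suc n))
  antidiagonal-applyUpTo h zero    = sym (identityʳ _)
  antidiagonal-applyUpTo h (suc n) = ∙-congˡ (antidiagonal-applyUpTo (h ∘ suc) n)

map-⋯ : ∀ {a} {A : Set a} (f : ℕ → A) lo hi →
        List.map f (lo ⋯ hi) ≡ applyUpTo (λ i → f (lo ℕ.+ i)) (suc hi ∸ lo)
map-⋯ f lo hi = ≡.trans (≡.sym (List.map-∘ (upTo (suc hi ∸ lo)))) (List.map-upTo _ _)

-- The numbers of perfect matchings.

-- The double factorial (2k-1)!!, the number of perfect matchings of 2k points.
oddFactorial : ℕ → ℕ
oddFactorial zero    = 1
oddFactorial (suc k) = suc (k ℕ.* 2) ℕ.* oddFactorial k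

-- The even factors of (2k)! multiply to `k ! ℕ.* 2 ℕ.^ k`, the odd ones to (2k-1)!!.
oddFactorial-! : ∀ k → oddFactorial k ℕ.* (k ! ℕ.* 2 ℕ.^ k) ≡ (k ℕ.* 2) !
oddFactorial-! zero    = ≡.refl
oddFactorial-! (suc k) = begin
  suc (k ℕ.* 2) ℕ.* o ℕ.* (suc k ℕ.* k ! ℕ.* (2 ℕ.* 2 ℕ.^ k))
    ≡⟨ solve 4 (λ k o f p → (con 1 :+ k :* con 2) :* o :* ((con 1 :+ k) :* f :* (con 2 :* p))
                          := (con 1 :+ (con 1 :+ k :* con 2)) :* ((con 1 :+ k :* con 2) :* (o :* (f :* p))))
         ≡.refl k o (k !) (2 ℕ.^ k) ⟩
  suc (suc (k ℕ.* 2)) ℕ.* (suc (k ℕ.* 2) ℕ.* (o ℕ.* (k ! ℕ.* 2 ℕ.^ k)))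
    ≡⟨ cong (λ x → suc (suc (k ℕ.* 2)) ℕ.* (suc (k ℕ.* 2) ℕ.* x)) (oddFactorial-! k) ⟩
  (suc k ℕ.* 2) ! ∎
  where
  open ≡-Reasoning
  open ℕ.+-*-Solver
  o = oddFactorial k

pairingNumber≡oddFactorial : ∀ k → pairingNumber k ≡ oddFactorial k
pairingNumber≡oddFactorial k = begin
  (2 ℕ.* k) ! ℕ./ d              ≡⟨ cong (λ n → n ! ℕ./ d) (ℕ.*-comm 2 k) ⟩
  (k ℕ.* 2) ! ℕ./ d              ≡⟨ cong (ℕ._/ d) (oddFactorial-! k) ⟨
  oddFactorial k ℕ.* d ℕ./ d     ≡⟨ ℕ.m*n/n≡m (oddFactorial k) d ⟩
  oddFactorial k                 ∎
  where
  open ≡-Reasoning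
  d = k ! ℕ.* 2 ℕ.^ k
  instance
    d≢0 : NonZero d
    d≢0 = ℕ.m*n≢0 (k !) (2 ℕ.^ k) {{k ℕ.!≢0}} {{ℕ.m^n≢0 2 k}}

-- Counting disjoint pairs at distance two in an interval.

module ℕ∑ = Antidiagonal ℕ.+-0-commutativeMonoid

-- A trinomial coefficient: the arrangements of n tiles of three kinds, u of them longer than one
-- point and i of those of the longest kind.
placements : ℕ → ℕ → ℕ → ℕ
placements n u i = (n choose u) ℕ.* (u choose i)

-- Condition on one fixed tile. The summands correspond to lengths 1, 3 and 4, in this order.
placements-pascal : ∀ n u i → placements (suc n) (suc u) (suc i) ≡
  placements n (suc u) (suc i) ℕ.+ (placements n u (suc i) ℕ.+ placements n u i)
placements-pascal n u i
  rewrite ≡.sym (nCk+nC[k+1]≡[n+1]C[k+1] n u)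
        | ≡.sym (nCk+nC[k+1]≡[n+1]C[k+1] u i)
  = solve 4 (λ a b x y → (a :+ b) :* (x :+ y) := b :* (x :+ y) :+ (a :* y :+ a :* x)) ≡.refl
      (n choose u) (n choose suc u) (u choose i) (u choose suc i)
  where open ℕ.+-*-Solver

placements-pascal-0 : ∀ n u → placements (suc n) (suc u) 0 ≡
  placements n (suc u) 0 ℕ.+ placements n u 0
placements-pascal-0 n u rewrite ≡.sym (nCk+nC[k+1]≡[n+1]C[k+1] n u)
  = solve 2 (λ a b → (a :+ b) :* con 1 := b :* con 1 :+ a :* con 1) ≡.refl
      (n choose u) (n choose suc u)
  where open ℕ.+-*-Solver

placements-u<i : ∀ n {u i} → u < i → placements n u i ≡ 0
placements-u<i n {u} u<i = ≡.trans (cong ((n choose u) ℕ.*_) (k>n⇒nCk≡0 u<i)) (ℕ.*-zeroʳ (n choose u))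

placements-n<u : ∀ {n u} i → n < u → placements n u i ≡ 0
placements-n<u {u = u} i n<u = cong (ℕ._* (u choose i)) (k>n⇒nCk≡0 n<u)

placements-n<i : ∀ {n i} u → n < i → placements n u i ≡ 0
placements-n<i {n} {i} u n<i with n ℕ.<? u
... | yes n<u = placements-n<u i n<u
... | no  n≮u = placements-u<i n (ℕ.≤-<-trans (ℕ.≮⇒≥ n≮u) n<i)

-- Choosing j disjoint pairs {x, x + 2} in an interval so that f points stay free cuts the
-- interval into tiles of length 1 (a free point), 3 (x, x + 2 matched, x + 1 free) and 4 (two
-- interleaved pairs). With i tiles of length 4 there are i + f tiles, u = j − i of them longer
-- than 1; u and i are chosen by placements.
matchingCount : ℕ → ℕ → ℕ
matchingCount f = ℕ∑.antidiagonal (λ i u → placements (i ℕ.+ f) u i)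

matchingCount-1 : ∀ f → matchingCount (suc f) 1 ≡ matchingCount f 1 ℕ.+ matchingCount f 0
matchingCount-1 f rewrite ≡.sym (nCk+nC[k+1]≡[n+1]C[k+1] f 0) =
  solve 1 (λ x → (con 1 :+ x) :* con 1 :+ con 0 := x :* con 1 :+ con 0 :+ con 1) ≡.refl (f choose 1)
  where open ℕ.+-*-Solver

-- The end term with `u` = 0 vanishes, since `i` would exceed `u`. With the term at `i` = 0 set
-- apart, both indices are positive in the rest, as `placements-pascal` requires.
matchingCount-suc-suc : ∀ f j → matchingCount f (suc (suc j)) ≡
  placements f (suc (suc j)) 0 ℕ.+
  ℕ∑.antidiagonal (λ i u → placements (suc i ℕ.+ f) (suc u) (suc i)) j
matchingCount-suc-suc f j = begin
  matchingCount f (suc (suc j))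
    ≡⟨ ℕ∑.antidiagonal-last (λ i u → placements (i ℕ.+ f) u i) (suc j) ⟩
  t ℕ.+ placements (suc (suc j) ℕ.+ f) 0 (suc (suc j))
    ≡⟨ cong (t ℕ.+_) (placements-u<i (suc (suc j) ℕ.+ f) {0} {suc (suc j)} (s≤s z≤n)) ⟩
  t ℕ.+ 0
    ≡⟨ ℕ.+-identityʳ t ⟩
  t ∎
  where
  open ≡-Reasoning
  t = placements f (suc (suc j)) 0 ℕ.+
      ℕ∑.antidiagonal (λ i u → placements (suc i ℕ.+ f) (suc u) (suc i)) j

-- Tiles of length 1 and 3 each contain a free point, so only tiles of length 4 remain; deleting one
-- removes two pairs. Accordingly two of the three Pascal terms vanish.
matchingCount-0-suc-suc : ∀ j → matchingCount 0 (suc (suc j)) ≡ matchingCount 0 j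
matchingCount-0-suc-suc j = ≡.trans (matchingCount-suc-suc 0 j) (ℕ∑.antidiagonal-cong j term)
  where
  term : ∀ i u → i ℕ.+ u ≡ j →
         placements (suc i ℕ.+ 0) (suc u) (suc i) ≡ placements (i ℕ.+ 0) u i
  term i u _ rewrite ℕ.+-identityʳ i | placements-pascal i u i
    | placements-n<i {i} {suc i} (suc u) ℕ.≤-refl
    | placements-n<i {i} {suc i} u ℕ.≤-refl = ≡.refl

-- Condition on the kind of one tile: length 1 uses up a free point, length 3 a free point and a
-- pair, length 4 two pairs.
matchingCount-recurrence : ∀ f j → matchingCount (suc f) (suc (suc j)) ≡
  matchingCount f (suc (suc j)) ℕ.+ (matchingCount f (suc j) ℕ.+ matchingCount (suc f) j)
matchingCount-recurrence f j = begin
  matchingCount (suc f) (suc (suc j))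
    ≡⟨ matchingCount-suc-suc (suc f) j ⟩
  placements (suc f) (suc (suc j)) 0 ℕ.+
    ℕ∑.antidiagonal (λ i u → placements (suc i ℕ.+ suc f) (suc u) (suc i)) j
    ≡⟨ cong₂ ℕ._+_ (placements-pascal-0 f (suc j)) (ℕ∑.antidiagonal-cong j term) ⟩
  (a₀ ℕ.+ b₀) ℕ.+ ℕ∑.antidiagonal (λ i u → A i u ℕ.+ (B i u ℕ.+ D i u)) j
    ≡⟨ cong ((a₀ ℕ.+ b₀) ℕ.+_) (≡.trans (ℕ∑.antidiagonal-∙ A (λ i u → B i u ℕ.+ D i u) j)
         (cong (ℕ∑.antidiagonal A j ℕ.+_) (ℕ∑.antidiagonal-∙ B D j))) ⟩
  (a₀ ℕ.+ b₀) ℕ.+ (ℕ∑.antidiagonal A j ℕ.+ (ℕ∑.antidiagonal B j ℕ.+ ℕ∑.antidiagonal D j))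
    -- `b₀` with the sum of `B` is `matchingCount f (suc j)` by definition, and the sum of `D` is
    -- `matchingCount (suc f) j`.
    ≡⟨ solve 5 (λ x y a b d → (x :+ y) :+ (a :+ (b :+ d)) := (x :+ a) :+ ((y :+ b) :+ d)) ≡.refl
         a₀ b₀ (ℕ∑.antidiagonal A j) (ℕ∑.antidiagonal B j) (ℕ∑.antidiagonal D j) ⟩
  (a₀ ℕ.+ ℕ∑.antidiagonal A j) ℕ.+ (matchingCount f (suc j) ℕ.+ matchingCount (suc f) j)
    ≡⟨ cong (ℕ._+ (matchingCount f (suc j) ℕ.+ matchingCount (suc f) j)) (matchingCount-suc-suc f j) ⟨
  matchingCount f (suc (suc j)) ℕ.+ (matchingCount f (suc j) ℕ.+ matchingCount (suc f) j) ∎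
  where
  open ≡-Reasoning
  open ℕ.+-*-Solver using (solve; _:=_; _:+_)
  A B D : ℕ → ℕ → ℕ
  A i u = placements (suc i ℕ.+ f) (suc u) (suc i)
  B i u = placements (suc i ℕ.+ f) u (suc i)
  D i u = placements (i ℕ.+ suc f) u i
  a₀ = placements f (suc (suc j)) 0
  b₀ = placements f (suc j) 0
  term : ∀ i u → i ℕ.+ u ≡ j →
         placements (suc i ℕ.+ suc f) (suc u) (suc i) ≡ A i u ℕ.+ (B i u ℕ.+ D i u)
  term i u _ rewrite ℕ.+-suc i f = placements-pascal (suc i ℕ.+ f) u i

-- Without free points all pairs come in interleaved twos. This is what makes the outer sum start at
-- 1 for odd m.
matchingCount-odd : ∀ m → m % 2 ≡ 1 → matchingCount 0 m ≡ 0
matchingCount-odd (suc zero)    _   = ≡.refl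
matchingCount-odd (suc (suc m)) odd = ≡.trans (matchingCount-0-suc-suc m) (matchingCount-odd m odd)

-- The limits of the inner sum.

sum-zero : ∀ (f : ℕ → ℕ) n → (∀ i → f i ≡ 0) → ℕ.sum (applyUpTo f n) ≡ 0
sum-zero f zero    f≡0 = ≡.refl
sum-zero f (suc n) f≡0 = cong₂ ℕ._+_ (f≡0 0) (sum-zero (f ∘ suc) n (f≡0 ∘ suc))

sum-trim : ∀ (f : ℕ → ℕ) {lo hi n} → lo ≤ hi → hi ≤ n →
           (∀ i → i < lo → f i ≡ 0) → (∀ i → hi ≤ i → f i ≡ 0) →
           ℕ.sum (applyUpTo f n) ≡ ℕ.sum (applyUpTo (λ i → f (lo ℕ.+ i)) (hi ∸ lo))
sum-trim f {n = n} z≤n z≤n below above = sum-zero f n (λ i → above i z≤n)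
sum-trim f z≤n (s≤s hi≤n) below above =
  cong (f 0 ℕ.+_) (sum-trim (f ∘ suc) z≤n hi≤n (λ _ ()) (λ i → above (suc i) ∘ s≤s))
sum-trim f (s≤s lo≤hi) (s≤s hi≤n) below above =
  cong₂ ℕ._+_ (below 0 (s≤s z≤n))
    (sum-trim (f ∘ suc) lo≤hi hi≤n (λ i → below (suc i) ∘ s≤s) (λ i → above (suc i) ∘ s≤s))

i<⌈n/2⌉⇒i+i<n : ∀ {i} n → i < ⌈ n /2⌉ → i ℕ.+ i < n
i<⌈n/2⌉⇒i+i<n {zero}  (suc n)       _       = s≤s z≤n
i<⌈n/2⌉⇒i+i<n {suc i} (suc (suc n)) (s≤s p) =
  s≤s (≡.subst (_< suc n) (≡.sym (ℕ.+-suc i i)) (s≤s (i<⌈n/2⌉⇒i+i<n n p)))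
i<⌈n/2⌉⇒i+i<n {suc i} (suc zero)    (s≤s ())

⌊n/2⌋<i⇒n<i+i : ∀ {i} n → ⌊ n /2⌋ < i → n < i ℕ.+ i
⌊n/2⌋<i⇒n<i+i {suc i} zero          _       = s≤s z≤n
⌊n/2⌋<i⇒n<i+i {suc i} (suc zero)    _       rewrite ℕ.+-suc i i = s≤s (s≤s z≤n)
⌊n/2⌋<i⇒n<i+i {suc i} (suc (suc n)) (s≤s p) rewrite ℕ.+-suc i i = s≤s (s≤s (⌊n/2⌋<i⇒n<i+i n p))

-- Below the lower limit f + i < j - i and the first binomial vanishes; above the upper limit j - i
-- < i and the second one does.
matchingCount-∑ : ∀ j f →
  (∑ℕ[ i ∈ ⌈ j ∸ f /2⌉ ⋯ ⌊ j /2⌋ ] ((f ℕ.+ i) choose (j ∸ i)) ℕ.* ((j ∸ i) choose i)) ≡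
  matchingCount f j
matchingCount-∑ j f = begin
  ℕ.sum (List.map F (lo ⋯ hi))
    ≡⟨ cong ℕ.sum (map-⋯ F lo hi) ⟩
  ℕ.sum (applyUpTo (λ i → F (lo ℕ.+ i)) (suc hi ∸ lo))
    ≡⟨ sum-trim F lo≤suc-hi (s≤s (ℕ.⌊n/2⌋≤n j)) below above ⟨
  ℕ.sum (applyUpTo F (suc j))
    ≡⟨ ℕ∑.antidiagonal-applyUpTo (λ i u → placements (f ℕ.+ i) u i) j ⟨
  ℕ∑.antidiagonal (λ i u → placements (f ℕ.+ i) u i) j
    ≡⟨ ℕ∑.antidiagonal-cong j (λ i u _ → cong (λ n → placements n u i) (ℕ.+-comm f i)) ⟩
  matchingCount f j ∎
  where
  open ≡-Reasoning
  lo = ⌈ j ∸ f /2⌉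
  hi = ⌊ j /2⌋
  F : ℕ → ℕ
  F i = placements (f ℕ.+ i) (j ∸ i) i
  lo≤suc-hi : lo ≤ suc hi
  -- By computation `lo` is the floored half of `suc (j ∸ f)` and `suc hi` that of `suc (suc j)`.
  lo≤suc-hi = ℕ.⌊n/2⌋-mono (ℕ.≤-trans (s≤s (ℕ.m∸n≤m j f)) (ℕ.n≤1+n (suc j)))
  below : ∀ i → i < lo → F i ≡ 0
  below i i<lo = placements-n<u i
    (ℕ.m+n≤o⇒m≤o∸n (suc (f ℕ.+ i))
      (≡.subst (ℕ._≤ j) (cong suc eq)
      (ℕ.m≤o∸n⇒m+n≤o (suc (i ℕ.+ i))
        (ℕ.<⇒≤ (ℕ.m∸n≢0⇒n<m (ℕ.m<n⇒n≢0 i+i<j∸f))) i+i<j∸f)))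
    where
    i+i<j∸f = i<⌈n/2⌉⇒i+i<n (j ∸ f) i<lo
    eq : i ℕ.+ i ℕ.+ f ≡ f ℕ.+ i ℕ.+ i
    eq = ≡.trans (ℕ.+-comm (i ℕ.+ i) f) (≡.sym (ℕ.+-assoc f i i))
  above : ∀ i → hi < i → F i ≡ 0
  above i@(suc _) hi<i = placements-u<i (f ℕ.+ i) (ℕ.m<n+o⇒m∸n<o j i (⌊n/2⌋<i⇒n<i+i j hi<i))

module _ {c ℓ} (R : CommutativeRing c ℓ) where
  open CommutativeRing R hiding (zero)
  open Exp semiring using (_^_)
  open Mult semiring using (_×_; ×-congʳ; ×-congˡ; ×-homo-1; ×-homo-+; ×-comm-*; ×-assoc-*; ×1-homo-*)
  open CommutativeMonoidMult +-commutativeMonoid using (×-distrib-+)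
  open CommutativeSemigroupProperties (CommutativeMonoid.commutativeSemigroup +-commutativeMonoid)
    using (interchange)
  open GroupProperties +-group using (∙-cancelʳ)
  open HafnianOver R
  open Antidiagonal +-commutativeMonoid
    renaming (antidiagonal-∙ to antidiagonal-+; antidiagonal to ∑-antidiagonal)
  open RingSolver commutativeSemiring using (solve; _:=_; _:+_; _:*_; con)
  open import Relation.Binary.Reasoning.Setoid setoid

  -- Finite sums in the ring.

  *-distribˡ-antidiagonal : ∀ x h n → x * ∑-antidiagonal h n ≈ ∑-antidiagonal (λ i j → x * h i j) n
  *-distribˡ-antidiagonal x h zero    = refl
  *-distribˡ-antidiagonal x h (suc n) =
    trans (distribˡ _ _ _) (+-congˡ (*-distribˡ-antidiagonal x (h ∘ suc) n))

  ×-zeroʳ : ∀ n → n × 0# ≈ 0#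
  ×-zeroʳ zero    = refl
  ×-zeroʳ (suc n) = trans (+-identityˡ _) (×-zeroʳ n)

  ∑-++ : ∀ {a} {A : Set a} (xs ys : List A) (f : A → Carrier) → ∑ (xs ++ ys) f ≈ ∑ xs f + ∑ ys f
  ∑-++ []       ys f = sym (+-identityˡ _)
  ∑-++ (x ∷ xs) ys f = trans (+-congˡ (∑-++ xs ys f)) (sym (+-assoc _ _ _))

  ∑-cong : ∀ {a} {A : Set a} (xs : List A) {f g : A → Carrier} → (∀ x → f x ≈ g x) → ∑ xs f ≈ ∑ xs g
  ∑-cong []       f≈g = refl
  ∑-cong (x ∷ xs) f≈g = +-cong (f≈g x) (∑-cong xs f≈g)

  ∑-concatMap : ∀ {a b} {A : Set a} {B : Set b} (g : A → List B) (xs : List A) (f : B → Carrier) →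
                ∑ (concatMap g xs) f ≈ ∑ xs (λ x → ∑ (g x) f)
  ∑-concatMap g []       f = refl
  ∑-concatMap g (x ∷ xs) f = trans (∑-++ (g x) _ f) (+-congˡ (∑-concatMap g xs f))

  ∑-map-*ˡ : ∀ {a b} {A : Set a} {B : Set b} x
             (g : A → B) (xs : List A) (f : B → Carrier) (f′ : A → Carrier) →
             (∀ y → f (g y) ≈ x * f′ y) → ∑ (List.map g xs) f ≈ x * ∑ xs f′
  ∑-map-*ˡ x g []       f f′ eq = sym (zeroʳ x)
  ∑-map-*ˡ x g (y ∷ ys) f f′ eq =
    trans (+-cong (eq y) (∑-map-*ˡ x g ys f f′ eq)) (sym (distribˡ x _ _))

  ∑-tabulate-cong : ∀ {a n} {A : Set a} (g : Fin n → A) (f : A → Carrier) (f′ : Fin n → Carrier) →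
    (∀ i → f (g i) ≈ f′ i) → ∑ (List.tabulate g) f ≈ List.foldr _+_ 0# (List.tabulate f′)
  ∑-tabulate-cong {n = zero}  g f f′ eq = refl
  ∑-tabulate-cong {n = suc n} g f f′ eq =
    +-cong (eq zero) (∑-tabulate-cong (g ∘ suc) f (f′ ∘ suc) (eq ∘ suc))

  -- Selecting an entry of a list, and weighted matchings.

  module _ {a} {A : Set a} where

    -- The sum over all ways to take out one entry, the others keeping their order: an index-free
    -- form of the choice made by `lookup` and `removeAt` in `pairings`.
    ∑-select : (A → List A → Carrier) → List A → Carrier
    ∑-select f []       = 0#
    ∑-select f (x ∷ xs) = f x xs + ∑-select (λ y ys → f y (x ∷ ys)) xs

    ∑-select-cong : ∀ {f g} xs → (∀ y ys → suc (length ys) ≡ length xs → f y ys ≈ g y ys) →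
                    ∑-select f xs ≈ ∑-select g xs
    ∑-select-cong []       f≈g = refl
    ∑-select-cong (x ∷ xs) f≈g =
      +-cong (f≈g x xs ≡.refl) (∑-select-cong xs (λ y ys eq → f≈g y (x ∷ ys) (cong suc eq)))

    ∑-select-+ : ∀ f g xs → ∑-select (λ y ys → f y ys + g y ys) xs ≈ ∑-select f xs + ∑-select g xs
    ∑-select-+ f g []       = sym (+-identityˡ 0#)
    ∑-select-+ f g (x ∷ xs) = trans (+-congˡ (∑-select-+ _ _ xs)) (interchange _ _ _ _)

    *-distribˡ-∑-select : ∀ x f xs → x * ∑-select f xs ≈ ∑-select (λ y ys → x * f y ys) xs
    *-distribˡ-∑-select x f []       = zeroʳ x
    *-distribˡ-∑-select x f (y ∷ ys) =
      trans (distribˡ _ _ _) (+-congˡ (*-distribˡ-∑-select x _ ys))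

    ∑-select-zero : ∀ {f} xs → (∀ y ys → suc (length ys) ≡ length xs → f y ys ≈ 0#) →
                    ∑-select f xs ≈ 0#
    ∑-select-zero []       f≈0 = refl
    ∑-select-zero (x ∷ xs) f≈0 = trans
      (+-cong (f≈0 x xs ≡.refl) (∑-select-zero xs (λ y ys eq → f≈0 y (x ∷ ys) (cong suc eq))))
      (+-identityˡ 0#)

    ∑-select-× : ∀ n f xs → ∑-select (λ y ys → n × f y ys) xs ≈ n × ∑-select f xs
    ∑-select-× zero    f xs = ∑-select-zero xs (λ _ _ _ → refl)
    ∑-select-× (suc n) f xs = trans (∑-select-+ _ _ xs) (+-congˡ (∑-select-× n f xs))

    ∑-select-antidiagonal : ∀ (f : ℕ → ℕ → A → List A → Carrier) n xs →
      ∑-select (λ y ys → ∑-antidiagonal (λ i j → f i j y ys) n) xs ≈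
      ∑-antidiagonal (λ i j → ∑-select (f i j) xs) n
    ∑-select-antidiagonal f zero    xs = refl
    ∑-select-antidiagonal f (suc n) xs =
      trans (∑-select-+ _ _ xs) (+-congˡ (∑-select-antidiagonal (f ∘ suc) n xs))

    -- The list left by two removals does not depend on their order.
    ∑-select-swap : ∀ (f : A → A → List A → Carrier) xs →
      ∑-select (λ y ys → ∑-select (f y) ys) xs ≈
      ∑-select (λ y ys → ∑-select (λ z → f z y) ys) xs
    ∑-select-swap f []       = refl
    ∑-select-swap f (x ∷ xs) = begin
      ∑-select (f x) xs + ∑-select (λ y ys → f y x ys + ∑-select (λ z zs → f y z (x ∷ zs)) ys) xs
        ≈⟨ +-congˡ (∑-select-+ (λ y → f y x) _ xs) ⟩
      ∑-select (f x) xs + (∑-select (λ y → f y x) xs +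
        ∑-select (λ y ys → ∑-select (λ z zs → f y z (x ∷ zs)) ys) xs)
        ≈⟨ +-congˡ (+-congˡ (∑-select-swap (λ y z zs → f y z (x ∷ zs)) xs)) ⟩
      ∑-select (f x) xs + (∑-select (λ y → f y x) xs +
        ∑-select (λ y ys → ∑-select (λ z zs → f z y (x ∷ zs)) ys) xs)
        ≈⟨ solve 3 (λ a b c → a :+ (b :+ c) := b :+ (a :+ c)) refl _ _ _ ⟩
      ∑-select (λ y → f y x) xs + (∑-select (f x) xs +
        ∑-select (λ y ys → ∑-select (λ z zs → f z y (x ∷ zs)) ys) xs)
        ≈⟨ +-congˡ (∑-select-+ (f x) _ xs) ⟨
      ∑-select (λ y → f y x) xs +
        ∑-select (λ y ys → f x y ys + ∑-select (λ z zs → f z y (x ∷ zs)) ys) xs ∎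

    ∑-select-toList : ∀ (f : A → List A → Carrier) {n} (xs : Vec A (suc n)) →
      List.foldr _+_ 0# (List.tabulate (λ j → f (lookup xs j) (toList (removeAt xs j)))) ≈
      ∑-select f (toList xs)
    ∑-select-toList f (x ∷ [])         = refl
    ∑-select-toList f (x ∷ xs@(_ ∷ _)) = +-congˡ (∑-select-toList (λ y ys → f y (x ∷ ys)) xs)

    -- Weighted by the product of d over the j pairs; the first argument of d is the entry that
    -- comes earlier in the list.
    matchings : (A → A → Carrier) → ℕ → List A → Carrier
    matchings d zero    xs       = 1#
    matchings d (suc j) []       = 0#
    matchings d (suc j) (x ∷ xs) =
      matchings d (suc j) xs + ∑-select (λ y ys → d x y * matchings d j ys) xs

    matchings-zero : ∀ d j xs → length xs < j ℕ.* 2 → matchings d j xs ≈ 0#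
    matchings-zero d (suc j) []       _         = refl
    matchings-zero d (suc j) (x ∷ xs) (s≤s len) = trans
      (+-cong (matchings-zero d (suc j) xs (ℕ.<-trans len (ℕ.n<1+n _)))
              (∑-select-zero xs (λ y ys eq → trans
                (*-congˡ (matchings-zero d j ys (ℕ.s<s⁻¹ (≡.subst (_< suc (j ℕ.* 2)) (≡.sym eq) len))))
                (zeroʳ _))))
      (+-identityˡ 0#)

    -- Double counting: each j-edge matching survives the deletion of the |xs| − 2j points that it
    -- leaves free.
    ∑-select-matchings : ∀ d j xs →
      ∑-select (λ _ → matchings d j) xs + (j ℕ.* 2) × matchings d j xs ≈ length xs × matchings d j xs
    ∑-select-matchings d zero    []       = +-identityˡ 0#
    ∑-select-matchings d zero    (x ∷ xs) = trans (+-assoc _ _ _) (+-congˡ (∑-select-matchings d zero xs))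
    ∑-select-matchings d (suc j) []       = trans (+-identityˡ _) (×-zeroʳ (suc j ℕ.* 2))
    ∑-select-matchings d (suc j) (x ∷ xs) = begin
      (m + ∑-select (λ y ys → matchings d (suc j) ys +
                              ∑-select (λ z zs → d x z * matchings d j zs) ys) xs)
        + (suc j ℕ.* 2) × (m + σ)
        ≈⟨ +-cong (+-congˡ (trans (∑-select-+ (λ _ → matchings d (suc j)) _ xs) (+-congˡ swapped)))
                  (×-distrib-+ m σ (suc j ℕ.* 2)) ⟩
      (m + (s + χ)) + ((suc j ℕ.* 2) × m + (σ + (σ + (j ℕ.* 2) × σ)))
        ≈⟨ solve 6 (λ m s χ jm σ jσ → (m :+ (s :+ χ)) :+ (jm :+ (σ :+ (σ :+ jσ))) :=
                                   (m :+ (s :+ jm)) :+ (σ :+ (χ :+ (σ :+ jσ)))) refl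
             m s χ ((suc j ℕ.* 2) × m) σ ((j ℕ.* 2) × σ) ⟩
      (m + (s + (suc j ℕ.* 2) × m)) + (σ + (χ + (σ + (j ℕ.* 2) × σ)))
        -- The two copies of `σ` split off from the multiple `suc j ℕ.* 2` stand for the two ends of
        -- the pair at `x`: one accounts for `x` in the length, the other for its partner, which the
        -- induction at `ys` does not count.
        ≈⟨ +-cong (+-congˡ (∑-select-matchings d (suc j) xs)) (+-congˡ inner) ⟩
      suc (length xs) × m + suc (length xs) × σ
        ≈⟨ ×-distrib-+ m σ (suc (length xs)) ⟨
      suc (length xs) × (m + σ) ∎
      where
      m = matchings d (suc j) xs
      s = ∑-select (λ _ → matchings d (suc j)) xs
      σ = ∑-select (λ y ys → d x y * matchings d j ys) xs
      χ = ∑-select (λ y ys → d x y * ∑-select (λ _ → matchings d j) ys) xs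
      swapped : ∑-select (λ y ys → ∑-select (λ z zs → d x z * matchings d j zs) ys) xs ≈ χ
      swapped = trans (∑-select-swap (λ y z zs → d x z * matchings d j zs) xs)
        (∑-select-cong xs (λ y ys _ → sym (*-distribˡ-∑-select (d x y) _ ys)))
      inner : χ + (σ + (j ℕ.* 2) × σ) ≈ length xs × σ
      inner = begin
        χ + suc (j ℕ.* 2) × σ
          ≈⟨ +-congˡ (∑-select-× (suc (j ℕ.* 2)) _ xs) ⟨
        χ + ∑-select (λ y ys → suc (j ℕ.* 2) × (d x y * matchings d j ys)) xs
          ≈⟨ ∑-select-+ _ _ xs ⟨
        ∑-select (λ y ys → d x y * ∑-select (λ _ → matchings d j) ys +
                           suc (j ℕ.* 2) × (d x y * matchings d j ys)) xs
          ≈⟨ ∑-select-cong xs term ⟩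
        ∑-select (λ y ys → length xs × (d x y * matchings d j ys)) xs
          ≈⟨ ∑-select-× (length xs) _ xs ⟩
        length xs × σ ∎
        where
        term : ∀ y ys → suc (length ys) ≡ length xs →
               d x y * ∑-select (λ _ → matchings d j) ys + suc (j ℕ.* 2) × (d x y * matchings d j ys) ≈
               length xs × (d x y * matchings d j ys)
        term y ys eq = begin
          d x y * e + suc (j ℕ.* 2) × (d x y * n)
            ≈⟨ +-congˡ (×-comm-* (suc (j ℕ.* 2)) (d x y) n) ⟨
          d x y * e + d x y * (n + (j ℕ.* 2) × n)
            ≈⟨ solve 4 (λ d e n jn → d :* e :+ d :* (n :+ jn) := d :* (n :+ (e :+ jn))) refl
                 (d x y) e n ((j ℕ.* 2) × n) ⟩
          d x y * (n + (e + (j ℕ.* 2) × n))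
            ≈⟨ *-congˡ (+-congˡ (∑-select-matchings d j ys)) ⟩
          d x y * (suc (length ys) × n)
            ≈⟨ ×-comm-* (suc (length ys)) (d x y) n ⟩
          suc (length ys) × (d x y * n)
            ≈⟨ ×-congˡ eq ⟩
          length xs × (d x y * n) ∎
          where
          n = matchings d j ys
          e = ∑-select (λ _ → matchings d j) ys

    -- Here 2k + 1 points stay free. The multiples by 2j are cancelled as summands of the additive
    -- group, so no division takes place.
    ∑-select-matchings-odd : ∀ d k j xs → length xs ≡ suc ((k ℕ.+ j) ℕ.* 2) →
      ∑-select (λ _ → matchings d j) xs ≈ suc (k ℕ.* 2) × matchings d j xs
    ∑-select-matchings-odd d k j xs len = ∙-cancelʳ ((j ℕ.* 2) × matchings d j xs) _ _ (begin
      ∑-select (λ _ → matchings d j) xs + (j ℕ.* 2) × matchings d j xs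
        ≈⟨ ∑-select-matchings d j xs ⟩
      length xs × matchings d j xs
        ≈⟨ ×-congˡ (≡.trans len (cong suc (ℕ.*-distribʳ-+ 2 k j))) ⟩
      (suc (k ℕ.* 2) ℕ.+ j ℕ.* 2) × matchings d j xs
        ≈⟨ ×-homo-+ _ (suc (k ℕ.* 2)) (j ℕ.* 2) ⟩
      suc (k ℕ.* 2) × matchings d j xs + (j ℕ.* 2) × matchings d j xs ∎)

    -- Expansion of the sum over pairings around a constant weight.

    module _ (b : Carrier) (w : A → A → Carrier) where

      private
        d : A → A → Carrier
        d x y = w x y - b

        -- The total weight of the perfect matchings of 2k points when every pair weighs `b`.
        β : ℕ → Carrier
        β k = b ^ k * (oddFactorial k × 1#)

      β-suc : ∀ k → β k * (b * (suc (k ℕ.* 2) × 1#)) ≈ β (suc k)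
      β-suc k = trans
        (solve 4 (λ p o b n → (p :* o) :* (b :* n) := (b :* p) :* (n :* o)) refl _ _ _ _)
        (*-congˡ (sym (×1-homo-* (suc (k ℕ.* 2)) (oddFactorial k))))

      -- The pairs of a partition split into the j pairs weighted d and the k pairs weighted b;
      -- the latter form an arbitrary partition of the 2k remaining points.
      ∑-pairings : ∀ m (xs : Vec A (m ℕ.* 2)) →
        (∑[ π ∈ pairings m xs ] ∏ (Vec.map (uncurry w) π)) ≈
        ∑-antidiagonal (λ k j → β k * matchings d j (toList xs)) m
      ∑-pairings zero    []       =
        trans (+-identityʳ 1#) (sym (trans (*-identityʳ _) (trans (*-identityˡ _) (×-homo-1 1#))))
      ∑-pairings (suc m) (x ∷ xs) = begin
        ∑ (pairings (suc m) (x ∷ xs)) F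
          ≈⟨ ∑-concatMap (λ j → List.map ((x , lookup xs j) ∷_) (pairings m (removeAt xs j)))
               (List.allFin (suc (m ℕ.* 2))) F ⟩
        ∑ (List.allFin (suc (m ℕ.* 2)))
          (λ j → ∑ (List.map ((x , lookup xs j) ∷_) (pairings m (removeAt xs j))) F)
          ≈⟨ ∑-tabulate-cong _ _ _ (λ j → trans
               (∑-map-*ˡ (w x (lookup xs j)) _ (pairings m (removeAt xs j)) F _ (λ _ → refl))
               (*-congˡ (∑-pairings m (removeAt xs j)))) ⟩
        List.foldr _+_ 0# (List.tabulate (λ j → H (lookup xs j) (toList (removeAt xs j))))
          ≈⟨ ∑-select-toList H xs ⟩
        ∑-select H V
          -- The pair containing `x` contributes `b` or `d x y`.
          ≈⟨ ∑-select-cong V (λ y ys _ → trans (*-distribˡ-antidiagonal _ _ m)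
               (antidiagonal-cong m (λ k j _ → split y ys k j))) ⟩
        ∑-select (λ y ys → ∑-antidiagonal (λ k j →
          β k * b * matchings d j ys + β k * (d x y * matchings d j ys)) m) V
          ≈⟨ ∑-select-antidiagonal (λ k j y ys →
               β k * b * matchings d j ys + β k * (d x y * matchings d j ys)) m V ⟩
        ∑-antidiagonal (λ k j → ∑-select (λ y ys →
          β k * b * matchings d j ys + β k * (d x y * matchings d j ys)) V) m
          -- If it contributes `b`, its partner is any of the 2k + 1 points of `V` left free by the
          -- `d`-pairs; this factor turns `β k` into `β (suc k)`.
          ≈⟨ antidiagonal-cong m (λ k j eq → trans
               (∑-select-+ _ _ V)
               (+-cong (unselect k j eq) (sym (*-distribˡ-∑-select (β k) _ V)))) ⟩
        ∑-antidiagonal (λ k j → β (suc k) * matchings d j V + β k * σ j) m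
          ≈⟨ antidiagonal-+ _ _ m ⟩
        ∑-antidiagonal (λ k j → β (suc k) * matchings d j V) m + ∑-antidiagonal (λ k j → β k * σ j) m
          -- The new term at `k` = 0 is zero: it asks for m + 1 pairs among 2m + 1 points.
          ≈⟨ +-congʳ shift ⟩
        ∑-antidiagonal (λ k j → β k * matchings d j V) (suc m) + ∑-antidiagonal (λ k j → β k * σ j) m
          -- With the term at `j` = 0 split off, the two sums match the two cases of
          -- `matchings d (suc j) (x ∷ V)`: `x` outside every `d`-pair, or inside one.
          ≈⟨ +-congʳ (antidiagonal-last (λ k j → β k * matchings d j V) m) ⟩
        (∑-antidiagonal (λ k j → β k * matchings d (suc j) V) m + β (suc m) * 1#) +
          ∑-antidiagonal (λ k j → β k * σ j) m
          ≈⟨ solve 3 (λ a b c → (a :+ b) :+ c := (a :+ c) :+ b) refl _ _ _ ⟩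
        (∑-antidiagonal (λ k j → β k * matchings d (suc j) V) m +
          ∑-antidiagonal (λ k j → β k * σ j) m) +
          β (suc m) * 1#
          ≈⟨ +-congʳ (antidiagonal-+ _ _ m) ⟨
        ∑-antidiagonal (λ k j → β k * matchings d (suc j) V + β k * σ j) m + β (suc m) * 1#
          ≈⟨ +-congʳ (antidiagonal-cong m (λ k j _ → distribˡ (β k) _ _)) ⟨
        ∑-antidiagonal (λ k j → β k * matchings d (suc j) (x ∷ V)) m + β (suc m) * 1#
          ≈⟨ antidiagonal-last (λ k j → β k * matchings d j (x ∷ V)) m ⟨
        ∑-antidiagonal (λ k j → β k * matchings d j (x ∷ V)) (suc m) ∎
        where
        F = λ π → ∏ (Vec.map (uncurry w) π)
        V = toList xs
        V-length = Vec.length-toList xs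
        H : A → List A → Carrier
        H y ys = w x y * ∑-antidiagonal (λ k j → β k * matchings d j ys) m
        σ : ℕ → Carrier
        σ j = ∑-select (λ y ys → d x y * matchings d j ys) V

        w≈b+d : ∀ y → w x y ≈ b + d x y
        w≈b+d y = sym (begin
          b + (w x y - b)   ≈⟨ solve 3 (λ b w -b → b :+ (w :+ -b) := w :+ (b :+ -b)) refl b (w x y) (- b) ⟩
          w x y + (b - b)   ≈⟨ +-congˡ (-‿inverseʳ b) ⟩
          w x y + 0#        ≈⟨ +-identityʳ _ ⟩
          w x y             ∎)

        split : ∀ y ys k j → w x y * (β k * matchings d j ys) ≈
                β k * b * matchings d j ys + β k * (d x y * matchings d j ys)
        split y ys k j = trans (*-congʳ (w≈b+d y))
          (solve 4 (λ b d p n → (b :+ d) :* (p :* n) := (p :* b) :* n :+ p :* (d :* n)) refl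
             b (d x y) (β k) (matchings d j ys))

        unselect : ∀ k j → k ℕ.+ j ≡ m →
          ∑-select (λ y ys → β k * b * matchings d j ys) V ≈ β (suc k) * matchings d j V
        unselect k j eq = begin
          ∑-select (λ y ys → β k * b * matchings d j ys) V
            ≈⟨ *-distribˡ-∑-select (β k * b) (λ _ → matchings d j) V ⟨
          β k * b * ∑-select (λ _ → matchings d j) V
            ≈⟨ *-congˡ (∑-select-matchings-odd d k j V
                 (≡.trans V-length (cong (λ n → suc (n ℕ.* 2)) (≡.sym eq)))) ⟩
          β k * b * (suc (k ℕ.* 2) × μ)
            ≈⟨ *-congˡ (×-congʳ (suc (k ℕ.* 2)) (*-identityˡ μ)) ⟨
          β k * b * (suc (k ℕ.* 2) × (1# * μ))
            ≈⟨ *-congˡ (×-assoc-* (suc (k ℕ.* 2)) 1# μ) ⟨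
          β k * b * ((suc (k ℕ.* 2) × 1#) * μ)
            ≈⟨ solve 4 (λ p b n μ → (p :* b) :* (n :* μ) := (p :* (b :* n)) :* μ) refl _ _ _ _ ⟩
          β k * (b * (suc (k ℕ.* 2) × 1#)) * μ
            ≈⟨ *-congʳ (β-suc k) ⟩
          β (suc k) * μ ∎
          where μ = matchings d j V

        shift : ∑-antidiagonal (λ k j → β (suc k) * matchings d j V) m ≈
                ∑-antidiagonal (λ k j → β k * matchings d j V) (suc m)
        shift = sym (trans (+-congʳ (trans (*-congˡ (matchings-zero d (suc m) V
          (s≤s (ℕ.≤-reflexive V-length)))) (zeroʳ _))) (+-identityˡ _))

  -- From matrix indices to intervals of natural numbers.

  module _ {a b} {A : Set a} {B : Set b} (f : A → B) where

    ∑-select-map : ∀ (g : B → List B → Carrier) xs →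
      ∑-select (λ y ys → g (f y) (List.map f ys)) xs ≈ ∑-select g (List.map f xs)
    ∑-select-map g []       = refl
    ∑-select-map g (x ∷ xs) = +-congˡ (∑-select-map (λ y ys → g y (f x ∷ ys)) xs)

    matchings-map : ∀ (d : B → B → Carrier) j xs →
      matchings (λ x y → d (f x) (f y)) j xs ≈ matchings d j (List.map f xs)
    matchings-map d zero    xs       = refl
    matchings-map d (suc j) []       = refl
    matchings-map d (suc j) (x ∷ xs) = +-cong (matchings-map d (suc j) xs) (trans
      (∑-select-cong xs (λ y ys _ → *-congˡ (matchings-map d j ys)))
      (∑-select-map (λ y ys → d (f x) y * matchings d j ys) xs))

  -- The offset `s` and the map `f` are general because the tail of the vector is tabulated by
  -- `f ∘ suc`.
  toℕ-tabulate : ∀ {n N} s (f : Fin n → Fin N) → (∀ i → toℕ (f i) ≡ toℕ i ℕ.+ s) →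
    List.map toℕ (toList (Vec.tabulate f)) ≡ iterate suc s n
  toℕ-tabulate {zero}  s f eq = ≡.refl
  toℕ-tabulate {suc n} s f eq = cong₂ _∷_ (eq zero)
    (toℕ-tabulate (suc s) (f ∘ suc) (λ i → ≡.trans (eq (suc i)) (≡.sym (ℕ.+-suc (toℕ i) s))))

  -- Matchings of an interval under the Toeplitz weights.

  module _ (a b : Carrier) where

    private
      δ : Carrier
      δ = a - b

    excess : ℕ → ℕ → Carrier
    excess x y = firstRow a b ∣ x - y ∣ - b

    excess-1 : ∀ s → excess s (suc s) ≈ 0#
    excess-1 zero    = -‿inverseʳ b
    excess-1 (suc s) = excess-1 s

    excess-2 : ∀ s → excess s (suc (suc s)) ≈ δ
    excess-2 zero    = refl
    excess-2 (suc s) = excess-2 s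

    excess-≥3 : ∀ s t → excess s (3 ℕ.+ t ℕ.+ s) ≈ 0#
    excess-≥3 zero    t = -‿inverseʳ b
    excess-≥3 (suc s) t rewrite ℕ.+-suc t s = excess-≥3 s t

    -- In the form `3 ℕ.+ t ℕ.+ s` the next point is by computation the one for `suc t`. The
    -- function `f` is arbitrary so that it can absorb the points passed over.
    excess-far : ∀ (f : List ℕ → Carrier) s t n →
      ∑-select (λ y ys → excess s y * f ys) (iterate suc (3 ℕ.+ t ℕ.+ s) n) ≈ 0#
    excess-far f s t zero    = refl
    excess-far f s t (suc n) = trans
      (+-cong (trans (*-congʳ (excess-≥3 s t)) (zeroˡ _))
              (excess-far (λ ys → f (_ ∷ ys)) s (suc t) n))
      (+-identityˡ 0#)

    excess-near : ∀ (f : List ℕ → Carrier) s n →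
      ∑-select (λ y ys → excess s y * f ys) (iterate suc (2 ℕ.+ s) (suc n)) ≈
      δ * f (iterate suc (3 ℕ.+ s) n)
    excess-near f s n = trans
      (+-cong (*-congʳ (excess-2 s)) (excess-far (λ ys → f (_ ∷ ys)) s 0 n))
      (+-identityʳ _)

    excess-interval : ∀ (f : List ℕ → Carrier) s n →
      ∑-select (λ y ys → excess s y * f ys) (iterate suc (1 ℕ.+ s) (2 ℕ.+ n)) ≈
      δ * f (suc s ∷ iterate suc (3 ℕ.+ s) n)
    excess-interval f s n = trans
      (+-cong (trans (*-congʳ (excess-1 s)) (zeroˡ _)) (excess-near (λ ys → f (_ ∷ ys)) s n))
      (+-identityˡ _)

    -- The least vertex s is free, or matched to s + 2; then s + 1 is free, or matched to s + 3.
    matchings-interval-step : ∀ j s n → matchings excess (2 ℕ.+ j) (iterate suc s (4 ℕ.+ n)) ≈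
      matchings excess (2 ℕ.+ j) (iterate suc (1 ℕ.+ s) (3 ℕ.+ n)) +
      δ * (matchings excess (1 ℕ.+ j) (iterate suc (3 ℕ.+ s) (1 ℕ.+ n)) +
            δ * matchings excess j (iterate suc (4 ℕ.+ s) n))
    matchings-interval-step j s n = +-congˡ (trans
      (excess-interval (matchings excess (suc j)) s (suc n))
      -- Once `s` and `s` + 2 are gone, the partner of `s` + 1 at distance two is the first point
      -- after it.
      (*-congˡ (+-congˡ (excess-near (matchings excess j) (suc s) n))))

    -- Both sides satisfy the same recursion, which removes the first tile. The length is tied to
    -- `j` and `f` by an equation because `j ℕ.* 2 ℕ.+ suc f` does not compute to a successor.
    matchings-interval : ∀ j f {n} s → n ≡ j ℕ.* 2 ℕ.+ f →
      matchings excess j (iterate suc s n) ≈ δ ^ j * (matchingCount f j × 1#)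
    matchings-interval zero f s eq = sym (trans (*-identityˡ _) (×-homo-1 1#))
    matchings-interval (suc zero) zero s ≡.refl = begin
      0# + 0# + (excess s (suc s) * 1# + 0#)
        -- The only two points are adjacent, so their pair has weight zero.
        ≈⟨ +-cong (+-identityˡ 0#) (trans (+-identityʳ _) (trans (*-congʳ (excess-1 s)) (zeroˡ _))) ⟩
      0# + 0#
        ≈⟨ +-identityˡ 0# ⟩
      0#
        ≈⟨ zeroʳ _ ⟨
      δ ^ 1 * 0# ∎
    matchings-interval (suc zero) (suc f) s ≡.refl = begin
      matchings excess 1 (iterate suc (suc s) (2 ℕ.+ f)) +
        ∑-select (λ y ys → excess s y * 1#) (iterate suc (suc s) (2 ℕ.+ f))
        ≈⟨ +-cong (matchings-interval 1 f (suc s) ≡.refl) (excess-interval (λ _ → 1#) s f) ⟩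
      δ ^ 1 * g 1 + δ * 1#
        ≈⟨ solve 2 (λ c x → c :* con 1 :* x :+ c :* con 1 := c :* con 1 :* (x :+ (con 1 :+ con 0)))
             refl δ (g 1) ⟩
      δ ^ 1 * (g 1 + g 0)
        ≈⟨ *-congˡ (×-homo-+ 1# (matchingCount f 1) 1) ⟨
      δ ^ 1 * ((matchingCount f 1 ℕ.+ 1) × 1#)
        ≈⟨ *-congˡ (×-congˡ (matchingCount-1 f)) ⟨
      δ ^ 1 * (matchingCount (suc f) 1 × 1#) ∎
      where
      g = λ j → matchingCount f j × 1#
    matchings-interval (suc (suc j)) zero s ≡.refl = begin
      matchings excess (2 ℕ.+ j) (iterate suc s (4 ℕ.+ n))
        ≈⟨ matchings-interval-step j s n ⟩
      matchings excess (2 ℕ.+ j) (iterate suc (1 ℕ.+ s) (3 ℕ.+ n)) +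
        δ * (matchings excess (1 ℕ.+ j) (iterate suc (3 ℕ.+ s) (1 ℕ.+ n)) +
              δ * matchings excess j (iterate suc (4 ℕ.+ s) n))
        -- The interval has just 2(j + 2) points, so leaving `s` or `s` + 1 free leaves too few for
        -- the remaining pairs.
        ≈⟨ +-cong (short (2 ℕ.+ j) (1 ℕ.+ s) (3 ℕ.+ n) (s≤s (s≤s (s≤s (s≤s n≤)))))
                  (*-congˡ (+-cong (short (1 ℕ.+ j) (3 ℕ.+ s) (1 ℕ.+ n) (s≤s (s≤s n≤)))
                                   (*-congˡ (matchings-interval j 0 (4 ℕ.+ s) ≡.refl)))) ⟩
      0# + δ * (0# + δ * (δ ^ j * (matchingCount 0 j × 1#)))
        ≈⟨ solve 3 (λ c p g → con 0 :+ c :* (con 0 :+ c :* (p :* g)) := c :* (c :* p) :* g) refl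
             δ (δ ^ j) (matchingCount 0 j × 1#) ⟩
      δ ^ (2 ℕ.+ j) * (matchingCount 0 j × 1#)
        ≈⟨ *-congˡ (×-congˡ (matchingCount-0-suc-suc j)) ⟨
      δ ^ (2 ℕ.+ j) * (matchingCount 0 (2 ℕ.+ j) × 1#) ∎
      where
      n = j ℕ.* 2 ℕ.+ 0
      n≤ : n ≤ j ℕ.* 2
      n≤ = ℕ.≤-reflexive (ℕ.+-identityʳ _)
      short : ∀ j s n → n < j ℕ.* 2 → matchings excess j (iterate suc s n) ≈ 0#
      short j s n n<2j = matchings-zero excess j _
        (≡.subst (_< j ℕ.* 2) (≡.sym (List.length-iterate suc s n)) n<2j)
    matchings-interval (suc (suc j)) (suc f) s ≡.refl = begin
      matchings excess (2 ℕ.+ j) (iterate suc s (4 ℕ.+ n))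
        ≈⟨ matchings-interval-step j s n ⟩
      matchings excess (2 ℕ.+ j) (iterate suc (1 ℕ.+ s) (3 ℕ.+ n)) +
        δ * (matchings excess (1 ℕ.+ j) (iterate suc (3 ℕ.+ s) (1 ℕ.+ n)) +
              δ * matchings excess j (iterate suc (4 ℕ.+ s) n))
        ≈⟨ +-cong (matchings-interval (2 ℕ.+ j) f (1 ℕ.+ s) (cong (3 ℕ.+_) n≡))
                  (*-congˡ (+-cong (matchings-interval (1 ℕ.+ j) f (3 ℕ.+ s) (cong suc n≡))
                                   (*-congˡ (matchings-interval j (suc f) (4 ℕ.+ s) ≡.refl)))) ⟩
      δ ^ (2 ℕ.+ j) * (p × 1#) + δ * (δ ^ (1 ℕ.+ j) * (q × 1#) + δ * (δ ^ j * (r × 1#)))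
        ≈⟨ solve 5 (λ c e p q r → c :* (c :* e) :* p :+ c :* (c :* e :* q :+ c :* (e :* r)) :=
                                  c :* (c :* e) :* (p :+ (q :+ r))) refl
             δ (δ ^ j) (p × 1#) (q × 1#) (r × 1#) ⟩
      δ ^ (2 ℕ.+ j) * (p × 1# + (q × 1# + r × 1#))
        ≈⟨ *-congˡ (trans (×-homo-+ 1# p (q ℕ.+ r)) (+-congˡ (×-homo-+ 1# q r))) ⟨
      δ ^ (2 ℕ.+ j) * ((p ℕ.+ (q ℕ.+ r)) × 1#)
        ≈⟨ *-congˡ (×-congˡ (matchingCount-recurrence f j)) ⟨
      δ ^ (2 ℕ.+ j) * (matchingCount (suc f) (2 ℕ.+ j) × 1#) ∎
      where
      n = j ℕ.* 2 ℕ.+ suc f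
      p = matchingCount f (2 ℕ.+ j)
      q = matchingCount f (1 ℕ.+ j)
      r = matchingCount (suc f) j
      n≡ : n ≡ suc (j ℕ.* 2 ℕ.+ f)
      n≡ = ℕ.+-suc (j ℕ.* 2) f

    -- Assembly of the formula.

    term : ℕ → ℕ → Carrier
    term k j = δ ^ j * b ^ k * ((oddFactorial k ℕ.* matchingCount (2 ℕ.* k) j) × 1#)

    -- The k pairs weighted `b` fill the points left free by the other j pairs, whence f = 2k in
    -- `matchingCount`.
    Hf-antidiagonal : ∀ m → Hf m (C (m ℕ.* 2) a b) ≈ ∑-antidiagonal term m
    Hf-antidiagonal m = trans (∑-pairings b (C (m ℕ.* 2) a b) m (Vec.allFin (m ℕ.* 2)))
      (antidiagonal-cong m λ k j k+j≡m → begin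
        b ^ k * (oddFactorial k × 1#) *
          matchings (λ x y → excess (toℕ x) (toℕ y)) j (toList (Vec.allFin (m ℕ.* 2)))
          ≈⟨ *-congˡ (matchings-map toℕ excess j _) ⟩
        b ^ k * (oddFactorial k × 1#) * matchings excess j (List.map toℕ (toList (Vec.allFin (m ℕ.* 2))))
          ≡⟨ cong (λ xs → b ^ k * (oddFactorial k × 1#) * matchings excess j xs)
               (toℕ-tabulate 0 (λ i → i) (λ i → ≡.sym (ℕ.+-identityʳ (toℕ i)))) ⟩
        b ^ k * (oddFactorial k × 1#) * matchings excess j (iterate suc 0 (m ℕ.* 2))
          ≈⟨ *-congˡ (matchings-interval j (2 ℕ.* k) 0 (length≡ k j k+j≡m)) ⟩
        b ^ k * (oddFactorial k × 1#) * (δ ^ j * (matchingCount (2 ℕ.* k) j × 1#))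
          ≈⟨ solve 4 (λ p o e g → p :* o :* (e :* g) := e :* p :* (o :* g)) refl _ _ _ _ ⟩
        δ ^ j * b ^ k * ((oddFactorial k × 1#) * (matchingCount (2 ℕ.* k) j × 1#))
          ≈⟨ *-congˡ (×1-homo-* (oddFactorial k) (matchingCount (2 ℕ.* k) j)) ⟨
        term k j ∎)
      where
      length≡ : ∀ k j → k ℕ.+ j ≡ m → m ℕ.* 2 ≡ j ℕ.* 2 ℕ.+ 2 ℕ.* k
      length≡ k j ≡.refl = ≡.trans (ℕ.*-distribʳ-+ 2 k j)
        (≡.trans (ℕ.+-comm (k ℕ.* 2) (j ℕ.* 2)) (cong (j ℕ.* 2 ℕ.+_) (ℕ.*-comm k 2)))

    term-odd : ∀ m → m % 2 ≡ 1 → term 0 m ≈ 0#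
    term-odd m odd = trans
      (*-congˡ (×-congˡ (≡.trans (ℕ.*-identityˡ (matchingCount 0 m)) (matchingCount-odd m odd))))
      (zeroʳ _)

    -- The remainder is a separate variable so that it can be split into cases; for r = 1 the term
    -- at k = 0 is dropped by `term-odd`.
    ∑-term : ∀ m r → r < 2 → m % 2 ≡ r → .{{_ : NonZero m}} →
      ∑-antidiagonal term m ≈ (∑[ k ∈ r ⋯ m ] term k (m ∸ k))
    ∑-term m zero _ _ = trans (antidiagonal-applyUpTo term m)
      (reflexive (cong (List.foldr _+_ 0#) (≡.sym (map-⋯ (λ k → term k (m ∸ k)) 0 m))))
    ∑-term (suc m) (suc zero) _ odd = trans
      (trans (+-congʳ (term-odd (suc m) odd)) (+-identityˡ _))
      (trans (antidiagonal-applyUpTo (term ∘ suc) m)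
        (reflexive (cong (List.foldr _+_ 0#) (≡.sym (map-⋯ (λ k → term k (suc m ∸ k)) 1 (suc m))))))
    ∑-term m (suc (suc r)) (s≤s (s≤s ())) _

    term-formula : ∀ m k → term k (m ∸ k) ≈ (δ ^ (m ∸ k) * b ^ k *
        ((pairingNumber k ℕ.*
          (∑ℕ[ i ∈ ⌈ m ∸ 3 ℕ.* k /2⌉ ⋯ ⌊ m ∸ k /2⌋ ]
            ((2 ℕ.* k ℕ.+ i) choose (m ∸ k ∸ i)) ℕ.* ((m ∸ k ∸ i) choose i)))
         × 1#))
    term-formula m k = *-congˡ (×-congˡ (cong₂ ℕ._*_ (≡.sym (pairingNumber≡oddFactorial k))
       (≡.trans (≡.sym (matchingCount-∑ (m ∸ k) (2 ℕ.* k)))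
         (cong (λ l → ∑ℕ[ i ∈ ⌈ l /2⌉ ⋯ ⌊ m ∸ k /2⌋ ]
            ((2 ℕ.* k ℕ.+ i) choose (m ∸ k ∸ i)) ℕ.* ((m ∸ k ∸ i) choose i))
            -- `3 ℕ.* k` computes to `k ℕ.+ 2 ℕ.* k`. Truncated subtraction supplies the maximum
            -- with 0 in the lower limit.
            (ℕ.∸-+-assoc m k (2 ℕ.* k))))))

theorem1 : ∀ {c ℓ} (R : CommutativeRing c ℓ) →
    let open CommutativeRing R
        open Exp semiring using (_^_)
        open Mult semiring using (_×_)
        open HafnianOver R
    in
    (a b : Carrier) (m : ℕ) → .{{_ : NonZero m}} →
    Hf m (C (m ℕ.* 2) a b) ≈
      (∑[ k ∈ m % 2 ⋯ m ]
        (a - b) ^ (m ∸ k) * b ^ k *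
        ((pairingNumber k ℕ.*
          (∑ℕ[ i ∈ ⌈ m ∸ 3 ℕ.* k /2⌉ ⋯ ⌊ m ∸ k /2⌋ ]
            ((2 ℕ.* k ℕ.+ i) choose (m ∸ k ∸ i)) ℕ.* ((m ∸ k ∸ i) choose i)))
         × 1#))
theorem1 R a b m = trans (Hf-antidiagonal R a b m) (trans
  (∑-term R a b m (m % 2) (ℕ.m%n<n m 2) ≡.refl)
  (∑-cong R (m % 2 ⋯ m) (term-formula R a b m)))
  where open CommutativeRing R using (trans)
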